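{- Let $A$ be a finite alphabet. Then, as families of languages in $A^*$, $$\Sigma_1[\mathcal{N}]\cap \mathbf{Reg}=\Sigma_1[\mathbf{Reg}]$$ and $$B\Sigma_1[\mathcal{N}]\cap \mathbf{Reg}=B\Sigma_1[\mathbf{Reg}].$$
   Context: Fix a finite alphabet $A$. Positions in a word $w\in A^*$ are the integers $1,\dots,|w|$. Structures. For a finite set of variables $\mathcal{V}=\{x_1,\dots,x_d\}$, a $\mathcal{V}$-structure over $A$ is a word over the extended alphabet $A\times 2^{\mathcal{V}}$ in which each variable of $\mathcal{V}$ appears (in the second components) exactly once. Equivalently, it is a word $w\in A^*$ together with a $d$-tuple $\mathbf{i}=(i_1,\dots,i_d)$ of positions of $w$ ($i_j$ being the position tagged with $x_j$); it is denoted $w(\mathbf{i})$. When $\mathcal V=\emptyset$, a structure is just a word over $A$. Numerical predicates. A numerical predicate $N$ with free variables $\mathcal{V}$ is a set of $\mathcal{V}$-structures such that if $w(\mathbf{i})\in N$ and $v$ is obtained from $w$ by changing one letter of $w$, then $v(\mathbf{i})\in N$. Thus membership depends only on $\mathbf{i}$ and the length $|w|$. (The set $\mathcal V$ may be empty, giving 0-ary predicates, which depend only on $|w|$.) A numerical predicate is regular if it is a regular language over the alphabet $A\times 2^{\mathcal{V}}$. Formulas. Atomic formulas are of two kinds: $a(x)$ for $a\in A$, meaning that the letter in position $x$ is $a$; and $N(y_1,\dots,y_m)$, where $N$ is a numerical predicate and $y_1,\dots,y_m$ are variables, meaning that the positions assigned to $y_1,\dots,y_m$, together with the length of the word, satisfy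 $N$. Quantifier-free formulas are boolean combinations of atomic formulas. Quantified variables range over positions of the word (so on the empty word a universally quantified sentence is vacuously true and an existentially quantified sentence is false). A $\Sigma_1$-sentence is a sentence $\exists x_1\cdots\exists x_d\,\phi$ with $d\geq 1$ and $\phi$ quantifier-free with free variables among $x_1,\dots,x_d$. A sentence $\psi$ defines the language $\{w\in A^*: w\models\psi\}$. Classes. $\mathbf{Reg}$ (as a class of languages) is the class of regular languages in $A^*$. $\Sigma_1[\mathcal{N}]$ is the class of languages in $A^*$ defined by $\Sigma_1$-sentences in which arbitrary numerical predicates are permitted. $\Sigma_1[\mathbf{Reg}]$ is the class of languages in $A^*$ defined by $\Sigma_1$-sentences in which all the numerical predicates used are regular. $B\Sigma_1[\mathcal{N}]$ and $B\Sigma_1[\mathbf{Reg}]$ are the closures of $\Sigma_1[\mathcal{N}]$ and $\Sigma_1[\mathbf{Reg}]$, respectively, under (finite) boolean operations, with complement taken in $A^*$. -}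

module Defs where

open import Data.Fin.Base using (Fin)
open import Data.Fin.Properties using (_≟_)
open import Data.Fin.Subset using (Subset; _∈_)
open import Data.List.Base using (List; foldl; length)
open import Data.Nat.Base using (ℕ; _≤_)
open import Data.Product.Base using (∃; _×_; _,_)
open import Data.Sum.Base using (_⊎_)
open import Data.Unit.Base using (⊤)
open import Data.Vec.Base using (Vec; _[_]≔_; fromList; lookup; map; tabulate; toList)
open import Level using (0ℓ; suc)
open import Relation.Binary.PropositionalEquality.Core using (_≡_)
open import Relation.Nullary.Decidable.Core using (⌊_⌋)
open import Relation.Nullary.Negation.Core using (¬_)
open import Relation.Unary using (Pred; _≐_; _∩_; _∪_; ∁)

Language : Set → Set₁
Language A = Pred (List A) 0ℓ

record DFA (A : Set) : Set where
  field
    states : ℕ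
    start  : Fin states
    step   : Fin states → A → Fin states
    final  : Subset states

  accepted : Language A
  accepted w = foldl step start w ∈ final

Reg : {A : Set} → Pred (Language A) 0ℓ
Reg {A} L = ∃ λ (M : DFA A) → L ≐ DFA.accepted M

-- A structure w(i₁, …, i_d); the variables x₁, …, x_d are the elements of Fin d.
record Structure (A : Set) (d : ℕ) : Set where
  constructor _⟨_⟩
  field
    {size}    : ℕ
    word      : Vec A size
    positions : Vec (Fin size) d

-- The same structure as a word over A × 2^𝒱: the letter at position p is tagged
-- with the set of those variables that are located at p.
encode : {A : Set} {d : ℕ} → Structure A d → List (A × Subset d)
encode (w ⟨ i ⟩) = toList (tabulate λ p → lookup w p , map (λ q → ⌊ q ≟ p ⌋) i)

record NumericalPredicate (A : Set) (d : ℕ) : Set₁ where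
  field
    holds       : Pred (Structure A d) 0ℓ
    letter-free : ∀ {n} (w : Vec A n) (i : Vec (Fin n) d) (p : Fin n) (a : A) →
                  holds (w ⟨ i ⟩) → holds ((w [ p ]≔ a) ⟨ i ⟩)

  encodings : Language (A × Subset d)
  encodings u = ∃ λ s → holds s × encode s ≡ u

open NumericalPredicate

NumericalClass : Set → Set₁
NumericalClass A = ∀ {m} → NumericalPredicate A m → Set

arbitrary : {A : Set} → NumericalClass A
arbitrary _ = ⊤

regular : {A : Set} → NumericalClass A
regular N = Reg (encodings N)

data Formula {A : Set} (𝒞 : NumericalClass A) (d : ℕ) : Set₁ where
  letter    : A → Fin d → Formula 𝒞 d
  numerical : ∀ {m} (N : NumericalPredicate A m) → 𝒞 N → Vec (Fin d) m → Formula 𝒞 d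
  neg       : Formula 𝒞 d → Formula 𝒞 d
  _and_     : Formula 𝒞 d → Formula 𝒞 d → Formula 𝒞 d
  _or_      : Formula 𝒞 d → Formula 𝒞 d → Formula 𝒞 d

infix 4 _⊨_

_⊨_ : {A : Set} {𝒞 : NumericalClass A} {d : ℕ} → Structure A d → Formula 𝒞 d → Set
(w ⟨ i ⟩) ⊨ letter a x       = lookup w (lookup i x) ≡ a
(w ⟨ i ⟩) ⊨ numerical N _ ys = holds N (w ⟨ map (lookup i) ys ⟩)
s ⊨ neg φ                    = ¬ (s ⊨ φ)
s ⊨ (φ and ψ)                = (s ⊨ φ) × (s ⊨ ψ)
s ⊨ (φ or ψ)                 = (s ⊨ φ) ⊎ (s ⊨ ψ)

-- ∃x₁ ⋯ ∃x_d φ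
record Σ₁-Sentence {A : Set} (𝒞 : NumericalClass A) : Set₁ where
  field
    d      : ℕ
    1≤d    : 1 ≤ d
    matrix : Formula 𝒞 d

defines : {A : Set} {𝒞 : NumericalClass A} → Σ₁-Sentence 𝒞 → Language A
defines ψ w = ∃ λ (i : Vec (Fin (length w)) d) → (fromList w ⟨ i ⟩) ⊨ matrix
  where open Σ₁-Sentence ψ

Σ₁[_] : {A : Set} → NumericalClass A → Pred (Language A) (suc 0ℓ)
Σ₁[ 𝒞 ] L = ∃ λ (ψ : Σ₁-Sentence 𝒞) → L ≐ defines ψ

-- Closure of a family of languages under finite boolean operations. As languages are
-- predicates, the closure must be made invariant under extensional equality explicitly.
data BooleanClosure {A : Set} (𝓕 : Pred (Language A) (suc 0ℓ)) : Pred (Language A) (suc 0ℓ) where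
  member       : ∀ {L} → 𝓕 L → BooleanClosure 𝓕 L
  union        : ∀ {K L} → BooleanClosure 𝓕 K → BooleanClosure 𝓕 L → BooleanClosure 𝓕 (K ∪ L)
  intersection : ∀ {K L} → BooleanClosure 𝓕 K → BooleanClosure 𝓕 L → BooleanClosure 𝓕 (K ∩ L)
  complement   : ∀ {L} → BooleanClosure 𝓕 L → BooleanClosure 𝓕 (∁ L)
  resp-≐       : ∀ {K L} → K ≐ L → BooleanClosure 𝓕 K → BooleanClosure 𝓕 L

BΣ₁[_] : {A : Set} → NumericalClass A → Pred (Language A) (suc 0ℓ)
BΣ₁[ 𝒞 ] = BooleanClosure Σ₁[ 𝒞 ]

{-# OPTIONS --safe #-}
-- A language L in Σ₁[𝒩] has bounded certificates: each w ∈ L has d positions such that every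
-- word of the same length with the same letters at these positions is in L. For a regular K, the
-- words that have such a certificate for K form the language Core d K. By the subset construction,
-- "all words with the letters a at the positions i lie in K" is a regular numerical predicate, so
-- Core d K is in Σ₁[Reg]. For L in Σ₁[𝒩] ∩ Reg we have L = Core d L.
--
-- For L in BΣ₁[𝒩] ∩ Reg, call a word resolved at stage j + 1 if it has a certificate for
-- L ∪ (resolved at stage j) or for ∁ L ∪ (resolved at stage j). Let L be a boolean combination of
-- U₁, …, U_t in Σ₁[𝒩], and fix joint certificates in w for the U_s that contain w. A word
-- agreeing with w there belongs to the same U_s as w, and so agrees with w about L, or belongs to
-- strictly more of them. Hence every nonempty word is resolved at stage t + 1, and L is obtained
-- by boolean operations from the regular sets of resolved words and their cores.
module Submission where

open import Defs
open import Data.Bool.Base using (Bool; true; false; _∧_; not)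
import Data.Bool.Properties as Bool
open import Data.Empty using (⊥; ⊥-elim)
open import Data.Fin.Base using (Fin; zero; suc; combine; remQuot; funToFin; finToFun)
open import Data.Fin.Properties using (_≟_; all?; any?; remQuot-combine; finToFun-funToFin; 2↔Bool)
open import Data.Fin.Subset using (Subset; ⁅_⁆; _∈_)
open import Data.Fin.Subset.Properties using (_∈?_; x∈⁅x⁆; x∈⁅y⁆⇒x≡y)
open import Data.List.Base as List using (List; []; _∷_; foldl; length)
open import Data.List.Membership.Propositional using () renaming (_∈_ to _∈ᴸ_; find to findᴸ; lose to loseᴸ)
open import Data.List.Membership.Propositional.Properties
  using (∈-map⁺; ∈-map⁻; ∈-filter⁺; ∈-filter⁻; ∈-allFin; ∈-cartesianProductWith⁺)
open import Data.List.Relation.Binary.Pointwise using (Pointwise; []; _∷_)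
open import Data.List.Relation.Unary.All using (All; []; _∷_)
import Data.List.Relation.Unary.All.Properties as All
open import Data.List.Relation.Unary.Any as Any using (here; there)
open import Data.Nat.Base using (ℕ; zero; suc; s≤s; z≤n; _+_; _*_; _^_; _<_; _≤_)
open import Data.Nat.Properties using (<-≤-trans; ≤-refl; m≤n⇒m≤1+n; n<1+n)
open import Data.Product.Base using (∃; _×_; _,_; proj₁; proj₂; uncurry)
open import Data.Product.Function.NonDependent.Propositional using (_×-⇔_)
open import Data.Sum.Base as Sum using (_⊎_; inj₁; inj₂)
open import Data.Sum.Function.Propositional using (_⊎-⇔_)
open import Data.Unit.Base using (tt)
open import Data.Vec.Base
  using (Vec; []; _∷_; _++_; _[_]≔_; allFin; fromList; lookup; map; replicate; tabulate; toList)
open import Data.Vec.Properties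
  using (++-injective; []=⇒lookup; cast-is-id; length-toList; lookup∘tabulate; lookup-map; lookup⇒[]=;
         map-++; map-cong; map-∘; map-lookup-allFin; tabulate-∘; tabulate-cong; tabulate∘lookup;
         toList-injective; toList-map; toList∘fromList)
open import Function.Base using (_∘_; case_of_)
open import Function.Bundles using (_⇔_; _↔_; _↪_; mk⇔; mk↪; Equivalence; module Inverse; module RightInverse)
open import Function.Construct.Composition using (_⇔-∘_)
open import Function.Construct.Identity using (⇔-id; ↪-id)
open import Function.Properties.Inverse using (↔⇒↣)
open import Function.Related.TypeIsomorphisms using (¬-cong-⇔)
open import Relation.Binary.Definitions using (DecidableEquality)
open import Relation.Binary.PropositionalEquality
  using (_≡_; refl; sym; trans; cong; cong₂; subst; module ≡-Reasoning)
open import Relation.Nullary using (Dec; yes; no; ¬_; ¬¬-excluded-middle)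
open import Relation.Nullary.Decidable
  using (⌊_⌋; does; dec-true; map′; ⌊⌋-map′; ¬?; _×-dec_; _⊎-dec_; _→-dec_; decidable-stable; via-injection)
open import Relation.Unary using (Decidable; _⊆_; _≐_; _∩_; _∪_; ∁; ∅; U)

open DFA
open Equivalence using (to; from)
open NumericalPredicate
open Structure using (size; positions)

private variable
  A B : Set
  d n : ℕ
  𝒞 : NumericalClass A

-- Regular languages

comprehension : {P : Fin n → Set} → Decidable P → Subset n
comprehension P? = tabulate (does ∘ P?)

does⁻ : {P : Set} (P? : Dec P) → does P? ≡ true → P
does⁻ (yes p) _ = p

∈-comprehension : {P : Fin n → Set} (P? : Decidable P) {x : Fin n} → x ∈ comprehension P? ⇔ P x
∈-comprehension P? {x} = mk⇔
  (λ x∈ → does⁻ (P? x) (trans (sym (lookup∘tabulate (does ∘ P?) x)) ([]=⇒lookup x∈)))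
  (λ px → lookup⇒[]= x _ (trans (lookup∘tabulate (does ∘ P?) x) (dec-true (P? x) px)))

subset↪Fin : Subset n ↪ Fin (2 ^ n)
subset↪Fin {n} = mk↪ {to = encodeSubset} {from = decodeSubset} λ {Q} → λ { refl →
    trans (tabulate-cong λ x → trans
      (cong (Inverse.to 2↔Bool) (finToFun-funToFin (Inverse.from 2↔Bool ∘ lookup Q) x))
      (Inverse.strictlyInverseˡ 2↔Bool (lookup Q x)))
    (tabulate∘lookup Q) }
  where
  encodeSubset : Subset n → Fin (2 ^ n)
  encodeSubset Q = funToFin (Inverse.from 2↔Bool ∘ lookup Q)

  decodeSubset : Fin (2 ^ n) → Subset n
  decodeSubset c = tabulate (Inverse.to 2↔Bool ∘ finToFun c)

pair↪Fin : ∀ {m n} → (Fin m × Fin n) ↪ Fin (m * n)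
pair↪Fin {m} {n} = mk↪ {to = uncurry combine} {from = remQuot n} λ { {p , q} refl → remQuot-combine p q }

acceptedFrom : (M : DFA A) → Fin (states M) → Language A
acceptedFrom M q w = foldl (step M) q w ∈ final M

-- If the states of a finite coalgebra are assigned languages that satisfy the derivative
-- equations, then these languages are regular.
module _ {S : Set} (S↪Fin : S ↪ Fin n) (⟦_⟧ : S → Language A) (δ : S → A → S)
         (nullable? : ∀ s → Dec (⟦ s ⟧ []))
         (derivative : ∀ s a w → ⟦ s ⟧ (a ∷ w) ⇔ ⟦ δ s a ⟧ w) where

  private
    module S = RightInverse S↪Fin

    automaton : S → DFA A
    automaton s = record
      { states = n
      ; start  = S.to s
      ; step   = λ q a → S.to (δ (S.from q) a)
      ; final  = comprehension (nullable? ∘ S.from)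
      }

    correct : ∀ s₀ s w → ⟦ s ⟧ w ⇔ acceptedFrom (automaton s₀) (S.to s) w
    correct s₀ s [] = mk⇔
      (λ ε∈ → from (∈-comprehension (nullable? ∘ S.from)) (subst (λ s → ⟦ s ⟧ []) (sym (S.strictlyInverseʳ s)) ε∈))
      (λ q∈ → subst (λ s → ⟦ s ⟧ []) (S.strictlyInverseʳ s) (to (∈-comprehension (nullable? ∘ S.from)) q∈))
    correct s₀ s (a ∷ w) rewrite S.strictlyInverseʳ s = mk⇔
      (λ aw∈ → to (correct s₀ (δ s a) w) (to (derivative s a w) aw∈))
      (λ q∈ → from (derivative s a w) (from (correct s₀ (δ s a) w) q∈))

  regular-by-derivatives : ∀ s → Reg ⟦ s ⟧
  regular-by-derivatives s = automaton s , to (correct s s _) , from (correct s s _)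

Reg-resp-≐ : {K L : Language A} → K ≐ L → Reg K → Reg L
Reg-resp-≐ (K⊆L , L⊆K) (M , K⊆M , M⊆K) = M , (λ x → K⊆M (L⊆K x)) , (λ x → K⊆L (M⊆K x))

Reg⇒decidable : {L : Language A} → Reg L → Decidable L
Reg⇒decidable (M , L⊆M , M⊆L) w = map′ M⊆L L⊆M (foldl (step M) (start M) w ∈? final M)

∅-regular : Reg {A} ∅
∅-regular = regular-by-derivatives (↪-id (Fin 1)) (λ _ → ∅) (λ q _ → q)
  (λ _ → no λ ()) (λ _ _ _ → ⇔-id _) zero

∁-regular : {L : Language A} → Reg L → Reg (∁ L)
∁-regular (M , L⊆M , M⊆L) = Reg-resp-≐ ((λ ∉M l → ∉M (L⊆M l)) , (λ ∉L m → ∉L (M⊆L m)))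
  (regular-by-derivatives (↪-id _) (λ q → ∁ (acceptedFrom M q)) (step M)
    (λ q → ¬? (q ∈? final M)) (λ _ _ _ → ⇔-id _) (start M))

∩-regular : {K L : Language A} → Reg K → Reg L → Reg (K ∩ L)
∩-regular (M , K⊆M , M⊆K) (N , L⊆N , N⊆L) =
  Reg-resp-≐ ((λ (m , n) → M⊆K m , N⊆L n) , (λ (k , l) → K⊆M k , L⊆N l))
  (regular-by-derivatives pair↪Fin (λ (p , q) → acceptedFrom M p ∩ acceptedFrom N q)
    (λ (p , q) a → step M p a , step N q a)
    (λ (p , q) → (p ∈? final M) ×-dec (q ∈? final N)) (λ _ _ _ → ⇔-id _) (start M , start N))

∪-regular : {K L : Language A} → Reg K → Reg L → Reg (K ∪ L)
∪-regular (M , K⊆M , M⊆K) (N , L⊆N , N⊆L) =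
  Reg-resp-≐ (Sum.map M⊆K N⊆L , Sum.map K⊆M L⊆N)
  (regular-by-derivatives pair↪Fin (λ (p , q) → acceptedFrom M p ∪ acceptedFrom N q)
    (λ (p , q) a → step M p a , step N q a)
    (λ (p , q) → (p ∈? final M) ⊎-dec (q ∈? final N)) (λ _ _ _ → ⇔-id _) (start M , start N))

⋂-regular : ∀ {d} (L : Fin d → Language A) → (∀ j → Reg (L j)) → Reg (λ w → ∀ j → L j w)
⋂-regular {d = ℕ.zero} L r = Reg-resp-≐ ((λ _ ()) , (λ _ ())) (∁-regular ∅-regular)
⋂-regular {d = ℕ.suc d} L r = Reg-resp-≐
  ((λ (h , t) → λ { zero → h ; (suc j) → t j }) , (λ f → f zero , f ∘ suc))
  (∩-regular (r zero) (⋂-regular (L ∘ suc) (r ∘ suc)))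

preimage-regular : (h : B → A) {L : Language A} → Reg L → Reg (L ∘ List.map h)
preimage-regular h {L} (M , L⊆M , M⊆L) = Reg-resp-≐ (M⊆L , L⊆M)
  (regular-by-derivatives (↪-id _) (λ q → acceptedFrom M q ∘ List.map h) (λ q b → step M q (h b))
    (λ q → q ∈? final M) (λ _ _ _ → ⇔-id _) (start M))

-- A nondeterministic letter-to-letter substitution. With `taggings` it erases tags, which is
-- existential quantification over positions; with `choices` it ranges over the words with
-- prescribed letters at the tagged positions.
Image : (B → List A) → Language A → Language B
Image f L u = ∃ λ v → Pointwise (λ c b → c ∈ᴸ f b) v u × L v

-- Subset construction: a set `Q` of states stands for the union of the images of the languages
-- accepted from its members.
Image-regular : (f : B → List A) {L : Language A} → Reg L → Reg (Image f L)
Image-regular {B = B} {A = A} f {L} (M , L⊆M , M⊆L) = Reg-resp-≐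
  ( (λ (q , q∈ , v , c , m) → v , c , M⊆L (subst (λ q → acceptedFrom M q v) (x∈⁅y⁆⇒x≡y (start M) q∈) m))
  , (λ (v , c , l) → start M , x∈⁅x⁆ (start M) , v , c , L⊆M l))
  (regular-by-derivatives subset↪Fin ⟦_⟧ δ nullable? derivative ⁅ start M ⁆)
  where
  ⟦_⟧ : Subset (states M) → Language B
  ⟦ Q ⟧ u = ∃ λ q → q ∈ Q × Image f (acceptedFrom M q) u

  Successor : Subset (states M) → B → Fin (states M) → Set
  Successor Q b q′ = ∃ λ q → q ∈ Q × Any.Any (λ c → q′ ≡ step M q c) (f b)

  successor? : ∀ Q b → Decidable (Successor Q b)
  successor? Q b q′ = any? λ q → (q ∈? Q) ×-dec Any.any? (λ c → q′ ≟ step M q c) (f b)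

  δ : Subset (states M) → B → Subset (states M)
  δ Q b = comprehension (successor? Q b)

  nullable? : ∀ Q → Dec (⟦ Q ⟧ [])
  nullable? Q = map′ (λ (q , q∈ , fin) → q , q∈ , [] , [] , fin) (λ { (q , q∈ , .[] , [] , fin) → q , q∈ , fin })
    (any? λ q → (q ∈? Q) ×-dec (q ∈? final M))

  derivative : ∀ Q b u → ⟦ Q ⟧ (b ∷ u) ⇔ ⟦ δ Q b ⟧ u
  derivative Q b u = mk⇔
    (λ { (q , q∈ , c ∷ v , c∈ ∷ v∈ , m) →
      step M q c , from (∈-comprehension (successor? Q b)) (q , q∈ , loseᴸ c∈ refl) , v , v∈ , m })
    λ (q′ , q′∈ , v , v∈ , m) → let
        q , q∈ , succ = to (∈-comprehension (successor? Q b)) q′∈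
        c , c∈ , q′≡ = findᴸ succ
      in q , q∈ , c ∷ v , c∈ ∷ v∈ , subst (λ q → acceptedFrom M q v) q′≡ m

-- Words with one or no marked letter

module _ (h : B → Bool) where

  ExactlyOnce Never : Language B
  ExactlyOnce u = ∃ λ p → ∀ q → h (lookup (fromList u) q) ≡ ⌊ p ≟ q ⌋
  Never u = ∀ q → h (lookup (fromList u) q) ≡ false

  private
    pattern once = zero
    pattern never = suc zero
    pattern dead = suc (suc zero)

    ⟦_⟧ : Fin 3 → Language B
    ⟦ once ⟧ = ExactlyOnce
    ⟦ never ⟧ = Never
    ⟦ dead ⟧ = ∅

    -- The automaton waits in `once` for the mark, then moves to `never`; a further mark is fatal.
    δ : Fin 3 → Bool → Fin 3
    δ once true = never
    δ never true = dead
    δ dead true = dead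
    δ q false = q

    nullable? : ∀ q → Dec (⟦ q ⟧ [])
    nullable? once = no λ ()
    nullable? never = yes λ ()
    nullable? dead = no λ ()

    suc≟suc : ∀ {n} (p q : Fin n) → ⌊ suc p ≟ suc q ⌋ ≡ ⌊ p ≟ q ⌋
    suc≟suc p q = ⌊⌋-map′ _ _ (p ≟ q)

    derivative : ∀ q b u → ⟦ q ⟧ (b ∷ u) ⇔ ⟦ δ q (h b) ⟧ u
    derivative once b u with h b in hb
    ... | true = mk⇔
      (λ { (zero , e) → e ∘ suc ; (suc p , e) → case trans (sym hb) (e zero) of λ () })
      (λ e → zero , λ { zero → hb ; (suc q) → e q })
    ... | false = mk⇔
      (λ { (zero , e) → case trans (sym hb) (e zero) of λ ()
         ; (suc p , e) → p , λ q → trans (e (suc q)) (suc≟suc p q) })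
      (λ (p , e) → suc p , λ { zero → hb ; (suc q) → trans (e q) (sym (suc≟suc p q)) })
    derivative never b u with h b in hb
    ... | true = mk⇔ (λ e → case trans (sym hb) (e zero) of λ ()) (λ ())
    ... | false = mk⇔ (λ e → e ∘ suc) (λ e → λ { zero → hb ; (suc q) → e q })
    derivative dead b u with h b
    ... | true = ⇔-id _
    ... | false = ⇔-id _

    regular-states : ∀ q → Reg ⟦ q ⟧
    regular-states = regular-by-derivatives (↪-id _) ⟦_⟧ (λ q b → δ q (h b)) nullable? derivative

  ExactlyOnce-regular : Reg ExactlyOnce
  ExactlyOnce-regular = regular-states once

  Never-regular : Reg Never
  Never-regular = regular-states never

-- Encodings of structures

⌊⌋⁺ : {P : Set} (P? : Dec P) → P → ⌊ P? ⌋ ≡ true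
⌊⌋⁺ (yes _) _ = refl
⌊⌋⁺ (no ¬p) p = ⊥-elim (¬p p)

⌊⌋⁻ : {P : Set} (P? : Dec P) → ⌊ P? ⌋ ≡ true → P
⌊⌋⁻ (yes p) _ = p

lookup-ext : {v w : Vec A n} → (∀ p → lookup v p ≡ lookup w p) → v ≡ w
lookup-ext {v = v} {w} e = trans (sym (tabulate∘lookup v)) (trans (tabulate-cong e) (tabulate∘lookup w))

-- An equality of pairs, because `length (toList v)` is not definitionally `n`.
fromList-toList : (v : Vec A n) → _≡_ {A = ∃ (Vec A)} (length (toList v) , fromList (toList v)) (n , v)
fromList-toList [] = refl
fromList-toList (a ∷ v) = cong (λ (n , v) → suc n , a ∷ v) (fromList-toList v)

fromList∘toList-⇔ : (P : ∀ {n} → Vec A n → Set) (v : Vec A n) → P (fromList (toList v)) ⇔ P v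
fromList∘toList-⇔ P v = mk⇔
  (subst (λ (_ , v) → P v) (fromList-toList v))
  (subst (λ (_ , v) → P v) (sym (fromList-toList v)))

module _ {R : A → B → Set} where

  Pointwise-toList⁺ : (v : Vec A n) (w : Vec B n) → (∀ p → R (lookup v p) (lookup w p)) →
                      Pointwise R (toList v) (toList w)
  Pointwise-toList⁺ [] [] r = []
  Pointwise-toList⁺ (a ∷ v) (b ∷ w) r = r zero ∷ Pointwise-toList⁺ v w (r ∘ suc)

  Pointwise-toList⁻ : ∀ {u} (w : Vec B n) → Pointwise R u (toList w) →
                      ∃ λ v → toList v ≡ u × (∀ p → R (lookup v p) (lookup w p))
  Pointwise-toList⁻ [] [] = [] , refl , λ ()
  Pointwise-toList⁻ (b ∷ w) (r ∷ rs) with Pointwise-toList⁻ w rs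
  ... | v , refl , rs′ = _ ∷ v , refl , λ { zero → r ; (suc p) → rs′ p }

vectors : List B → ∀ n → List (Vec B n)
vectors bs zero    = [] ∷ []
vectors bs (suc n) = List.cartesianProductWith _∷_ bs (vectors bs n)

∈-vectors : {bs : List B} → (∀ b → b ∈ᴸ bs) → (v : Vec B n) → v ∈ᴸ vectors bs n
∈-vectors b∈ []      = here refl
∈-vectors b∈ (b ∷ v) = ∈-cartesianProductWith⁺ _∷_ (b∈ b) (∈-vectors b∈ v)

tag : Vec A n → Vec (Fin n) d → Vec (A × Subset d) n
tag w i = tabulate λ p → lookup w p , map (λ q → ⌊ q ≟ p ⌋) i

module _ (w : Vec A n) (i : Vec (Fin n) d) (p : Fin n) where

  lookup-tag-word : proj₁ (lookup (tag w i) p) ≡ lookup w p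
  lookup-tag-word = cong proj₁ (lookup∘tabulate _ p)

  lookup-tag-positions : ∀ j → lookup (proj₂ (lookup (tag w i) p)) j ≡ ⌊ lookup i j ≟ p ⌋
  lookup-tag-positions j = trans
    (cong (λ x → lookup (proj₂ x) j) (lookup∘tabulate (λ p → lookup w p , map (λ q → ⌊ q ≟ p ⌋) i) p))
    (lookup-map j _ i)

-- Equal lengths give equal sizes. The tag of a variable is true only at its own position, so the
-- positions agree as well.
encode-injective : {s t : Structure A d} → encode s ≡ encode t → s ≡ t
encode-injective {A} {d} {v ⟨ i ⟩} {w ⟨ j ⟩} e =
  same-size v i w j (trans (sym (length-toList (tag v i))) (trans (cong length e) (length-toList (tag w j)))) e
  where
  same-size : ∀ {m n} (v : Vec A m) (i : Vec (Fin m) d) (w : Vec A n) (j : Vec (Fin n) d) → m ≡ n →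
              toList (tag v i) ≡ toList (tag w j) → _≡_ {A = Structure A d} (v ⟨ i ⟩) (w ⟨ j ⟩)
  same-size v i w j refl e = cong₂ _⟨_⟩
    (lookup-ext λ p → trans (sym (lookup-tag-word v i p)) (trans (cong (λ t → proj₁ (lookup t p)) tags) (lookup-tag-word w j p)))
    (lookup-ext λ x → sym (⌊⌋⁻ (lookup j x ≟ lookup i x) (begin
      ⌊ lookup j x ≟ lookup i x ⌋                     ≡⟨ lookup-tag-positions w j (lookup i x) x ⟨
      lookup (proj₂ (lookup (tag w j) (lookup i x))) x ≡⟨ cong (λ t → lookup (proj₂ (lookup t (lookup i x))) x) tags ⟨
      lookup (proj₂ (lookup (tag v i) (lookup i x))) x ≡⟨ lookup-tag-positions v i (lookup i x) x ⟩
      ⌊ lookup i x ≟ lookup i x ⌋                     ≡⟨ ⌊⌋⁺ (lookup i x ≟ lookup i x) refl ⟩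
      true                                             ∎)))
    where
    open ≡-Reasoning
    tags : tag v i ≡ tag w j
    tags = trans (sym (cast-is-id refl _)) (toList-injective refl (tag v i) (tag w j) e)

Valid : Language (A × Subset d)
Valid u = ∀ j → ExactlyOnce (λ x → lookup (proj₂ x) j) u

Valid-regular : Reg (Valid {A} {d})
Valid-regular = ⋂-regular _ λ j → ExactlyOnce-regular λ x → lookup (proj₂ x) j

Valid⁺ : (s : Structure A d) → Valid (encode s)
Valid⁺ {d = d} (w ⟨ i ⟩) j = from
  (fromList∘toList-⇔ (λ {n} v → ∃ λ p → ∀ q → lookup (proj₂ (lookup v q)) j ≡ ⌊ p ≟ q ⌋) (tag w i))
  (lookup i j , λ q → lookup-tag-positions w i q j)

Valid⁻ : (u : List (A × Subset d)) → Valid u → ∃ λ s → encode s ≡ u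
Valid⁻ u valid = word′ ⟨ positions′ ⟩ , trans (cong toList (lookup-ext λ p → cong₂ _,_
    (trans (lookup-tag-word word′ positions′ p) (lookup-map p proj₁ (fromList u)))
    (lookup-ext λ j → trans (lookup-tag-positions word′ positions′ p j) (trans
      (cong (λ q → ⌊ q ≟ p ⌋) (lookup∘tabulate (proj₁ ∘ valid) j)) (sym (proj₂ (valid j) p))))))
  (toList∘fromList u)
  where
  word′ = map proj₁ (fromList u)
  positions′ = tabulate (proj₁ ∘ valid)

rename : ∀ {m} → Vec (Fin d) m → A × Subset d → A × Subset m
rename ys (a , S) = a , map (lookup S) ys

-- The arguments `ys` of an atom may permute, repeat or omit variables. Since this amounts to a
-- relabelling of letters, regularity passes to the atom through a preimage.
encode-rename : ∀ {m} (ys : Vec (Fin d) m) (w : Vec A n) (i : Vec (Fin n) d) →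
                List.map (rename ys) (encode (w ⟨ i ⟩)) ≡ encode (w ⟨ map (lookup i) ys ⟩)
encode-rename ys w i = trans (sym (toList-map (rename ys) (tag w i))) (cong toList (trans
  (sym (tabulate-∘ (rename ys) _))
  (tabulate-cong λ p → cong (lookup w p ,_) (trans (map-cong (λ y → lookup-map y _ i) ys) (map-∘ _ _ ys)))))

encodings-encode : (N : NumericalPredicate A d) (s : Structure A d) → encodings N (encode s) ⇔ holds N s
encodings-encode N s = mk⇔ (λ (t , h , e) → subst (holds N) (encode-injective e) h) (λ h → s , h , refl)

-- Certificates and Σ₁[Reg]

Certificate : Language A → (w : Vec A n) → Vec (Fin n) d → Set
Certificate K w i = ∀ v → map (lookup v) i ≡ map (lookup w) i → K (toList v)

Core : ℕ → Language A → Language A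
Core d K w = ∃ λ (i : Vec (Fin (length w)) d) → Certificate K (fromList w) i

Core⊆ : {K : Language A} → Core d K ⊆ K
Core⊆ {K = K} {w} (i , c) = subst K (toList∘fromList w) (c (fromList w) refl)

module FiniteAlphabet {A : Set} {k : ℕ} (A↔Fin : A ↔ Fin k) where

  _≟ᴬ_ : DecidableEquality A
  _≟ᴬ_ = via-injection (↔⇒↣ A↔Fin) _≟_

  letters : List A
  letters = List.map (Inverse.from A↔Fin) (List.allFin k)

  ∈-letters : ∀ a → a ∈ᴸ letters
  ∈-letters a = subst (_∈ᴸ letters) (Inverse.strictlyInverseʳ A↔Fin a)
    (∈-map⁺ (Inverse.from A↔Fin) (∈-allFin (Inverse.to A↔Fin a)))

  -- `L` is constrained on encodings only, so complements are taken freely; `Valid` is intersected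
  -- once, when the variables are projected away.
  Recognizable : Formula (regular {A}) d → Set₁
  Recognizable {d} φ = ∃ λ (L : Language (A × Subset d)) → Reg L × (∀ s → L (encode s) ⇔ s ⊨ φ)

  -- A letter is wrong if it carries the tag of `x` but differs from `a`. In an encoding exactly one
  -- letter carries this tag.
  letter-recognizable : ∀ a (x : Fin d) → Recognizable (letter a x)
  letter-recognizable {d} a x = Never wrong , Never-regular wrong , λ (w ⟨ i ⟩) →
    mk⇔
      (λ e → ⌊⌋⁻ (lookup w (lookup i x) ≟ᴬ a) (right-letter _ _
        (trans (sym (wrong-tag w i (lookup i x))) (e (lookup i x))) (⌊⌋⁺ (lookup i x ≟ lookup i x) refl)))
      (λ e q → trans (wrong-tag w i q) (no-wrong w i e q))
    ⇔-∘ fromList∘toList-⇔ (λ v → ∀ q → wrong (lookup v q) ≡ false) (tag w i)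
    where
    wrong : A × Subset d → Bool
    wrong (b , S) = lookup S x ∧ not ⌊ b ≟ᴬ a ⌋

    wrong-tag : ∀ {n} (w : Vec A n) (i : Vec (Fin n) d) q →
                wrong (lookup (tag w i) q) ≡ ⌊ lookup i x ≟ q ⌋ ∧ not ⌊ lookup w q ≟ᴬ a ⌋
    wrong-tag w i q = cong₂ (λ s b → s ∧ not ⌊ b ≟ᴬ a ⌋) (lookup-tag-positions w i q x) (lookup-tag-word w i q)

    right-letter : ∀ s b → s ∧ not b ≡ false → s ≡ true → b ≡ true
    right-letter true true _ _ = refl

    no-wrong : ∀ {n} (w : Vec A n) (i : Vec (Fin n) d) → lookup w (lookup i x) ≡ a → ∀ q →
               ⌊ lookup i x ≟ q ⌋ ∧ not ⌊ lookup w q ≟ᴬ a ⌋ ≡ false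
    no-wrong w i e q with lookup i x ≟ q
    ... | no _ = refl
    ... | yes refl = cong not (⌊⌋⁺ (lookup w (lookup i x) ≟ᴬ a) e)

  recognizable : (φ : Formula (regular {A}) d) → Recognizable φ
  recognizable (letter a x) = letter-recognizable a x
  recognizable (numerical N N-regular ys) =
    encodings N ∘ List.map (rename ys) , preimage-regular (rename ys) N-regular , λ (w ⟨ i ⟩) →
    encodings-encode N _ ⇔-∘ mk⇔ (subst (encodings N) (encode-rename ys w i))
                                 (subst (encodings N) (sym (encode-rename ys w i)))
  recognizable (neg φ) = let L , r , e = recognizable φ in
    ∁ L , ∁-regular r , λ s → ¬-cong-⇔ (e s)
  recognizable (φ and ψ) = let K , q , e = recognizable φ ; L , r , f = recognizable ψ in
    K ∩ L , ∩-regular q r , λ s → e s ×-⇔ f s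
  recognizable (φ or ψ) = let K , q , e = recognizable φ ; L , r , f = recognizable ψ in
    K ∪ L , ∪-regular q r , λ s → e s ⊎-⇔ f s

  taggings : ∀ d → A → List (A × Subset d)
  taggings d a = List.map (a ,_) (vectors (true ∷ false ∷ []) d)

  ∈-taggings : (x : A × Subset d) → x ∈ᴸ taggings d (proj₁ x)
  ∈-taggings (a , S) = ∈-map⁺ (a ,_) (∈-vectors (λ { true → here refl ; false → there (here refl) }) S)

  map-proj₁-tagging : ∀ {u w} → Pointwise (λ x a → x ∈ᴸ taggings d a) u w → List.map proj₁ u ≡ w
  map-proj₁-tagging [] = refl
  map-proj₁-tagging (x∈ ∷ xs∈) with _ , _ , refl ← ∈-map⁻ (_ ,_) x∈ = cong (_ ∷_) (map-proj₁-tagging xs∈)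

  -- Existential quantification is projection: the tagged words that encode a model of the matrix
  -- form a regular language, and erasing the tags preserves regularity.
  Σ₁[regular]⇒Reg : {L : Language A} → Σ₁[ regular ] L → Reg L
  Σ₁[regular]⇒Reg (ψ , L⊆ψ , ψ⊆L) = Reg-resp-≐ ((λ i → ψ⊆L (image⊆ i)) , (λ l → ⊆image (L⊆ψ l)))
    (Image-regular (taggings _) (∩-regular Valid-regular (proj₁ (proj₂ (recognizable matrix)))))
    where
    open Σ₁-Sentence ψ using (matrix) renaming (d to e)
    K = proj₁ (recognizable matrix)
    K⇔ = proj₂ (proj₂ (recognizable matrix))

    ⊆image : defines ψ ⊆ Image (taggings e) (Valid ∩ K)
    ⊆image {w} (i , m) = encode (fromList w ⟨ i ⟩) ,
      subst (Pointwise _ _) (toList∘fromList w) (Pointwise-toList⁺ (tag (fromList w) i) (fromList w)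
        λ p → subst (λ a → lookup (tag (fromList w) i) p ∈ᴸ taggings e a) (lookup-tag-word (fromList w) i p) (∈-taggings _)) ,
      Valid⁺ (fromList w ⟨ i ⟩) , from (K⇔ (fromList w ⟨ i ⟩)) m

    image⊆ : Image (taggings e) (Valid ∩ K) ⊆ defines ψ
    image⊆ (v , pw , valid , m) with Valid⁻ v valid
    ... | w ⟨ i ⟩ , refl = subst (defines ψ)
      (trans (sym (trans (sym (toList-map proj₁ (tag w i)))
                (cong toList (lookup-ext λ p → trans (lookup-map p proj₁ (tag w i)) (lookup-tag-word w i p)))))
             (map-proj₁-tagging pw))
      (from (fromList∘toList-⇔ (λ w → ∃ λ i → (w ⟨ i ⟩) ⊨ matrix) w) (i , to (K⇔ (w ⟨ i ⟩)) m))

  module _ {K : Language A} (K-regular : Reg K) (a : Vec A d) where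

    -- The letters at the positions come from the parameter `a` and not from the structure, which
    -- makes the predicate independent of letters.
    forces : NumericalPredicate A d
    forces = record
      { holds       = λ s → ∀ (v : Vec A (size s)) → map (lookup v) (positions s) ≡ a → K (toList v)
      ; letter-free = λ _ _ _ _ h → h
      }

    private
      Compatible : Subset d → A → Set
      Compatible S c = ∀ j → lookup S j ≡ true → c ≡ lookup a j

      compatible? : ∀ S c → Dec (Compatible S c)
      compatible? S c = all? λ j → (lookup S j Bool.≟ true) →-dec (c ≟ᴬ lookup a j)

      choices : A × Subset d → List A
      choices (_ , S) = List.filter (compatible? S) letters

    -- The predicate fails when some word outside `K` has the letters `a` at the tagged positions.
    -- The tagged words with such a counterexample form the image of `∁ K` under `choices`.
    forces-regular : regular forces
    forces-regular = Reg-resp-≐ (⊆encodings , encodings⊆)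
      (∩-regular Valid-regular (∁-regular (Image-regular choices (∁-regular K-regular))))
      where
      encodings⊆ : encodings forces ⊆ Valid ∩ ∁ (Image choices (∁ K))
      encodings⊆ (w ⟨ i ⟩ , h , refl) = Valid⁺ (w ⟨ i ⟩) , λ (u , pw , ¬k) →
        case Pointwise-toList⁻ (tag w i) pw of λ { (v , refl , c) → ¬k (h v (lookup-ext λ j → trans
          (lookup-map j (lookup v) i)
          (proj₂ (∈-filter⁻ (compatible? (proj₂ (lookup (tag w i) (lookup i j)))) {xs = letters} (c (lookup i j))) j
            (trans (lookup-tag-positions w i (lookup i j) j) (⌊⌋⁺ (_ ≟ _) refl))))) }

      ⊆encodings : Valid ∩ ∁ (Image choices (∁ K)) ⊆ encodings forces
      ⊆encodings {u} (valid , ¬image) with Valid⁻ u valid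
      -- A regular `K` is decidable, so it suffices to refute a counterexample `v`.
      ... | w ⟨ i ⟩ , refl = w ⟨ i ⟩ , (λ v e → decidable-stable (Reg⇒decidable K-regular (toList v)) λ ¬k →
        ¬image (toList v , Pointwise-toList⁺ v (tag w i) (λ p → ∈-filter⁺ (compatible? (proj₂ (lookup (tag w i) p))) (∈-letters _)
          λ j t → trans (cong (lookup v) (sym (⌊⌋⁻ (_ ≟ _) (trans (sym (lookup-tag-positions w i p j)) t))))
            (trans (sym (lookup-map j (lookup v) i)) (cong (λ a → lookup a j) e))) , ¬k)) , refl

  -- Formulas have no constants; the empty 0-ary predicate supplies the empty disjunction.
  falsum : Formula (regular {A}) d
  falsum = numerical {m = 0} (record { holds = λ _ → ⊥ ; letter-free = λ _ _ _ _ () })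
    (Reg-resp-≐ ((λ ()) , λ ()) ∅-regular) []

  ⋁ : {X : Set} → (X → Formula (regular {A}) d) → List X → Formula (regular {A}) d
  ⋁ φ [] = falsum
  ⋁ φ (x ∷ xs) = φ x or ⋁ φ xs

  ⊨⋁⁺ : {X : Set} (φ : X → Formula (regular {A}) d) {s : Structure A d} {x : X} {xs : List X} →
         x ∈ᴸ xs → s ⊨ φ x → s ⊨ ⋁ φ xs
  ⊨⋁⁺ φ (here refl) h = inj₁ h
  ⊨⋁⁺ φ (there x∈) h = inj₂ (⊨⋁⁺ φ x∈ h)

  ⊨⋁⁻ : {X : Set} (φ : X → Formula (regular {A}) d) {s : Structure A d} (xs : List X) →
         s ⊨ ⋁ φ xs → ∃ λ x → s ⊨ φ x
  ⊨⋁⁻ φ (x ∷ xs) (inj₁ h) = x , h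
  ⊨⋁⁻ φ (x ∷ xs) (inj₂ h) = ⊨⋁⁻ φ xs h

  spells : ∀ {m} → Vec A m → Vec (Fin d) m → Formula (regular {A}) d → Formula (regular {A}) d
  spells [] [] φ = φ
  spells (a ∷ as) (x ∷ xs) φ = letter a x and spells as xs φ

  ⊨spells : ∀ {m} (w : Vec A n) (i : Vec (Fin n) d) (as : Vec A m) (xs : Vec (Fin d) m) φ →
            (w ⟨ i ⟩) ⊨ spells as xs φ ⇔ (map (lookup w) (map (lookup i) xs) ≡ as × (w ⟨ i ⟩) ⊨ φ)
  ⊨spells w i [] [] φ = mk⇔ (refl ,_) proj₂
  ⊨spells w i (a ∷ as) (x ∷ xs) φ = mk⇔
    (λ (e , h) → let es , m = to (⊨spells w i as xs φ) h in cong₂ _∷_ e es , m)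
    (λ { (refl , m) → refl , from (⊨spells w i as xs φ) (refl , m) })

  -- Over a finite alphabet the letters at the certificate take finitely many values `a`. The matrix
  -- is the disjunction over `a` of "the positions carry `a`", by letter atoms, and "`a` at these
  -- positions forces `K`", by a regular numerical predicate.
  Core-Σ₁ : {K : Language A} → Reg K → ∀ d → Σ₁[ regular ] (Core (suc d) K)
  Core-Σ₁ {K} K-regular d = ψ , Core⊆ψ , ψ⊆Core
    where
    core certified : Vec A (suc d) → Formula regular (suc d)
    core a = numerical (forces K-regular a) (forces-regular K-regular a) (allFin _)
    certified a = spells a (allFin _) (core a)

    ψ : Σ₁-Sentence regular
    ψ = record { d = suc d ; 1≤d = s≤s z≤n ; matrix = ⋁ certified (vectors letters (suc d)) }

    ⊨certified : (w : Vec A n) (i : Vec (Fin n) (suc d)) (a : Vec A (suc d)) →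
                 (w ⟨ i ⟩) ⊨ certified a ⇔ (map (lookup w) i ≡ a × (∀ v → map (lookup v) i ≡ a → K (toList v)))
    ⊨certified w i a = subst
      (λ i′ → (w ⟨ i ⟩) ⊨ certified a ⇔ (map (lookup w) i′ ≡ a × (∀ v → map (lookup v) i′ ≡ a → K (toList v))))
      (map-lookup-allFin i) (⊨spells w i a (allFin _) (core a))

    Core⊆ψ : Core (suc d) K ⊆ defines ψ
    Core⊆ψ {w} (i , c) = i , ⊨⋁⁺ certified (∈-vectors ∈-letters a) (from (⊨certified (fromList w) i a) (refl , c))
      where a = map (lookup (fromList w)) i

    ψ⊆Core : defines ψ ⊆ Core (suc d) K
    ψ⊆Core {w} (i , h) = i , λ v e → let
        a , h′ = ⊨⋁⁻ certified (vectors letters (suc d)) h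
        spelt , c = to (⊨certified (fromList w) i a) h′
      in c v (trans e spelt)

-- Locality of Σ₁-sentences

-- Letters are changed one at a time: the tail first, under the old head, then the head.
update-closed : (P : Vec A n → Set) → (∀ w p a → P w → P (w [ p ]≔ a)) → ∀ v w → P v → P w
update-closed P closed [] [] h = h
update-closed P closed (a ∷ v) (b ∷ w) h = closed (a ∷ w) zero b
  (update-closed (P ∘ (a ∷_)) (λ w p c → closed (a ∷ w) (suc p) c) v w h)

⊨-local : (φ : Formula 𝒞 d) (v w : Vec A n) (i : Vec (Fin n) d) → map (lookup v) i ≡ map (lookup w) i →
          (v ⟨ i ⟩) ⊨ φ ⇔ (w ⟨ i ⟩) ⊨ φ
⊨-local (letter a x) v w i e = mk⇔ (trans (sym same)) (trans same)
  where
  same : lookup v (lookup i x) ≡ lookup w (lookup i x)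
  same = trans (sym (lookup-map x (lookup v) i)) (trans (cong (λ b → lookup b x) e) (lookup-map x (lookup w) i))
⊨-local (numerical N _ ys) v w i e = mk⇔ (change v w) (change w v)
  where
  change = update-closed (λ w → holds N (w ⟨ map (lookup i) ys ⟩)) λ w p a → letter-free N w _ p a
⊨-local (neg φ) v w i e = ¬-cong-⇔ (⊨-local φ v w i e)
⊨-local (φ and ψ) v w i e = ⊨-local φ v w i e ×-⇔ ⊨-local ψ v w i e
⊨-local (φ or ψ) v w i e = ⊨-local φ v w i e ⊎-⇔ ⊨-local ψ v w i e

Certified : Language A → Set
Certified L = ∃ λ d → L ⊆ Core (suc d) L

-- The witnesses of the quantifiers are the certificate: by locality they satisfy the matrix in
-- every word that agrees with `w` there.
Σ₁⇒Certified : {L : Language A} → Σ₁[ 𝒞 ] L → Certified L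
Σ₁⇒Certified (record { d = suc d ; matrix = φ } , L⊆ψ , ψ⊆L) = d , λ {w} l → let i , h = L⊆ψ l in
  i , λ v e → ψ⊆L (from (fromList∘toList-⇔ (λ v → ∃ λ i → (v ⟨ i ⟩) ⊨ φ) v)
    (i , to (⊨-local φ (fromList w) v i (sym e)) h))

-- Inclusions between the classes

forget : Formula 𝒞 d → Formula arbitrary d
forget (letter a x) = letter a x
forget (numerical N _ ys) = numerical N tt ys
forget (neg φ) = neg (forget φ)
forget (φ and ψ) = forget φ and forget ψ
forget (φ or ψ) = forget φ or forget ψ

⊨-forget : (φ : Formula 𝒞 d) (s : Structure A d) → s ⊨ φ ⇔ s ⊨ forget φ
⊨-forget (letter a x) s = ⇔-id _
⊨-forget (numerical N _ ys) s = ⇔-id _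
⊨-forget (neg φ) s = ¬-cong-⇔ (⊨-forget φ s)
⊨-forget (φ and ψ) s = ⊨-forget φ s ×-⇔ ⊨-forget ψ s
⊨-forget (φ or ψ) s = ⊨-forget φ s ⊎-⇔ ⊨-forget ψ s

Σ₁⊆Σ₁[arbitrary] : Σ₁[ 𝒞 ] ⊆ Σ₁[ arbitrary ]
Σ₁⊆Σ₁[arbitrary] (ψ , L⊆ψ , ψ⊆L) =
  record { 1≤d = 1≤d ; matrix = forget matrix } ,
  (λ l → let i , h = L⊆ψ l in i , to (⊨-forget matrix _) h) ,
  (λ (i , h) → ψ⊆L (i , from (⊨-forget matrix _) h))
  where open Σ₁-Sentence ψ

BooleanClosure-mono : ∀ {𝓕 𝓖} → 𝓕 ⊆ 𝓖 → BooleanClosure {A} 𝓕 ⊆ BooleanClosure 𝓖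
BooleanClosure-mono 𝓕⊆𝓖 (member f) = member (𝓕⊆𝓖 f)
BooleanClosure-mono 𝓕⊆𝓖 (union b c) = union (BooleanClosure-mono 𝓕⊆𝓖 b) (BooleanClosure-mono 𝓕⊆𝓖 c)
BooleanClosure-mono 𝓕⊆𝓖 (intersection b c) = intersection (BooleanClosure-mono 𝓕⊆𝓖 b) (BooleanClosure-mono 𝓕⊆𝓖 c)
BooleanClosure-mono 𝓕⊆𝓖 (complement b) = complement (BooleanClosure-mono 𝓕⊆𝓖 b)
BooleanClosure-mono 𝓕⊆𝓖 (resp-≐ K≐L b) = resp-≐ K≐L (BooleanClosure-mono 𝓕⊆𝓖 b)

BooleanClosure-regular : ∀ {𝓕} → 𝓕 ⊆ Reg → BooleanClosure {A} 𝓕 ⊆ Reg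
BooleanClosure-regular 𝓕⊆Reg (member f) = 𝓕⊆Reg f
BooleanClosure-regular 𝓕⊆Reg (union b c) = ∪-regular (BooleanClosure-regular 𝓕⊆Reg b) (BooleanClosure-regular 𝓕⊆Reg c)
BooleanClosure-regular 𝓕⊆Reg (intersection b c) = ∩-regular (BooleanClosure-regular 𝓕⊆Reg b) (BooleanClosure-regular 𝓕⊆Reg c)
BooleanClosure-regular 𝓕⊆Reg (complement b) = ∁-regular (BooleanClosure-regular 𝓕⊆Reg b)
BooleanClosure-regular 𝓕⊆Reg (resp-≐ K≐L b) = Reg-resp-≐ K≐L (BooleanClosure-regular 𝓕⊆Reg b)

-- Boolean combinations

SameMembership : List (Language A) → List A → List A → Set₁
SameMembership Us v w = All (λ U → U v ⇔ U w) Us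

-- The shape of the boolean combination is discarded; only the finitely many certified languages
-- that determine `L` are kept.
generators : {L : Language A} → BΣ₁[ 𝒞 ] L →
             ∃ λ Us → All Certified Us × (∀ v w → SameMembership Us v w → L v ⇔ L w)
generators {L = L} (member σ) = L ∷ [] , Σ₁⇒Certified {L = L} σ ∷ [] , λ { v w (e ∷ []) → e }
generators (union b c) with generators b | generators c
... | Us , p , f | Vs , q , g = Us List.++ Vs , All.++⁺ p q ,
  λ v w e → f v w (All.++⁻ˡ Us e) ⊎-⇔ g v w (All.++⁻ʳ Us e)
generators (intersection b c) with generators b | generators c
... | Us , p , f | Vs , q , g = Us List.++ Vs , All.++⁺ p q ,
  λ v w e → f v w (All.++⁻ˡ Us e) ×-⇔ g v w (All.++⁻ʳ Us e)
generators (complement b) with generators b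
... | Us , p , f = Us , p , λ v w e → ¬-cong-⇔ (f v w e)
generators (resp-≐ (K⊆L , L⊆K) b) with generators b
... | Us , p , f = Us , p , λ v w e → mk⇔ (K⊆L ∘ to (f v w e) ∘ L⊆K) (K⊆L ∘ from (f v w e) ∘ L⊆K)

Decisions : List (Language A) → List A → Set₁
Decisions Us w = All (λ U → Dec (U w)) Us

-- With arbitrary numerical predicates the `Us` need not be decidable. Double negation is enough,
-- since the goals it serves concern regular languages and are stable.
¬¬-decisions : (Us : List (Language A)) (w : List A) → ¬ ¬ Decisions Us w
¬¬-decisions [] w k = k []
¬¬-decisions (U ∷ Us) w k = ¬¬-excluded-middle λ u → ¬¬-decisions Us w λ us → k (u ∷ us)

misses : ∀ {Us} {w : List A} → Decisions Us w → ℕ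
misses [] = 0
misses (yes _ ∷ us) = misses us
misses (no _ ∷ us) = suc (misses us)

misses≤length : ∀ {Us} {w : List A} (us : Decisions Us w) → misses us ≤ length Us
misses≤length [] = z≤n
misses≤length (yes _ ∷ us) = m≤n⇒m≤1+n (misses≤length us)
misses≤length (no _ ∷ us) = s≤s (misses≤length us)

-- No language is lost in passing from `v` to `w`, so either one is gained and the count drops, or
-- nothing changes.
misses-decrease : ∀ {Us} {v w : List A} (us : Decisions Us v) (us′ : Decisions Us w) →
                  All (λ U → U v → U w) Us →
                  misses us′ < misses us ⊎ (misses us′ ≡ misses us × SameMembership Us v w)
misses-decrease [] [] [] = inj₂ (refl , [])
misses-decrease (yes u ∷ us) (yes u′ ∷ us′) (_ ∷ m) =
  Sum.map₂ (λ (e , s) → e , mk⇔ (λ _ → u′) (λ _ → u) ∷ s) (misses-decrease us us′ m)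
misses-decrease (yes u ∷ us) (no ¬u ∷ us′) (f ∷ m) = ⊥-elim (¬u (f u))
misses-decrease (no ¬u ∷ us) (yes u ∷ us′) (_ ∷ m) with misses-decrease us us′ m
... | inj₁ lt = inj₁ (<-≤-trans lt (m≤n⇒m≤1+n ≤-refl))
-- The head is gained, so equal counts on the tails give a strict drop; for this the second
-- alternative carries the equality.
... | inj₂ (e , _) = inj₁ (subst (_< _) (sym e) (n<1+n _))
misses-decrease (no ¬u ∷ us) (no ¬u′ ∷ us′) (_ ∷ m) =
  Sum.map s≤s (λ (e , s) → cong suc e , mk⇔ (⊥-elim ∘ ¬u) (⊥-elim ∘ ¬u′) ∷ s) (misses-decrease us us′ m)

-- One less than the size of a joint certificate: each language contributes `suc d` positions and
-- the empty list a single one.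
width : ∀ {Us} → All (Certified {A}) Us → ℕ
width [] = 0
width ((d , _) ∷ cs) = d + suc (width cs)

joint-certificate : ∀ {Us} (cs : All Certified Us) (w : List A) → Fin (length w) → Decisions Us w →
  ∃ λ (i : Vec (Fin (length w)) (suc (width cs))) →
    ∀ (v : Vec A (length w)) → map (lookup v) i ≡ map (lookup (fromList w)) i → All (λ U → U w → U (toList v)) Us
joint-certificate [] w p [] = p ∷ [] , λ _ _ → []
joint-certificate {A = A} {U ∷ Us} ((d , U⊆) ∷ cs) w p (u? ∷ us) = i ++ is , λ v e → let
    e₁ , e₂ = ++-injective (map (lookup v) i) (map (lookup (fromList w)) i)
      (trans (sym (map-++ (lookup v) i is)) (trans e (map-++ (lookup (fromList w)) i is)))
  in c v e₁ ∷ cs′ v e₂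
  where
  certificate : Dec (U w) → ∃ λ (i : Vec (Fin (length w)) (suc d)) →
    ∀ (v : Vec A (length w)) → map (lookup v) i ≡ map (lookup (fromList w)) i → U w → U (toList v)
  certificate (yes u) = let i , c = U⊆ u in i , λ v e _ → c v e
  -- There is nothing to certify. Copies of `p` pad the tuple, so that its length does not depend on
  -- `w`.
  certificate (no ¬u) = replicate _ p , λ _ _ u → ⊥-elim (¬u u)

  i = proj₁ (certificate u?)
  c = proj₂ (certificate u?)
  is = proj₁ (joint-certificate cs w p us)
  cs′ = proj₂ (joint-certificate cs w p us)

-- Stages of resolved words

module Alternation {A : Set} {k : ℕ} (A↔Fin : A ↔ Fin k) {L : Language A} (L-regular : Reg L) (e : ℕ) where
  open FiniteAlphabet A↔Fin

  Resolved : ℕ → Language A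
  Resolved zero = ∅
  Resolved (suc j) = Core (suc e) (L ∪ Resolved j) ∪ Core (suc e) (∁ L ∪ Resolved j)

  Core-regular : {K : Language A} → Reg K → Reg (Core (suc e) K)
  Core-regular K-regular = Σ₁[regular]⇒Reg (Core-Σ₁ K-regular e)

  -- `Core-Σ₁` applies to regular languages only, so each stage has to be regular for the next one
  -- to be expressible.
  Resolved-regular : ∀ j → Reg (Resolved j)
  Resolved-regular zero = ∅-regular
  Resolved-regular (suc j) = ∪-regular
    (Core-regular (∪-regular L-regular (Resolved-regular j)))
    (Core-regular (∪-regular (∁-regular L-regular) (Resolved-regular j)))

  -- Words whose first resolution is in favour of `L`: a certificate for `L ∪ Resolved j` puts a
  -- word not yet resolved at stage `j` into `L`.
  Accepted : ℕ → Language A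
  Accepted zero = ∅
  Accepted (suc j) = (Core (suc e) (L ∪ Resolved j) ∩ ∁ (Resolved j)) ∪ Accepted j

  Core∈BΣ₁ : {K : Language A} → Reg K → BΣ₁[ regular ] (Core (suc e) K)
  Core∈BΣ₁ K-regular = member (Core-Σ₁ K-regular e)

  Resolved∈BΣ₁ : ∀ j → BΣ₁[ regular ] (Resolved j)
  -- The empty language is its own core.
  Resolved∈BΣ₁ zero = resp-≐ ((λ {w} → Core⊆ {K = ∅} {w}) , λ ()) (Core∈BΣ₁ ∅-regular)
  Resolved∈BΣ₁ (suc j) = union
    (Core∈BΣ₁ (∪-regular L-regular (Resolved-regular j)))
    (Core∈BΣ₁ (∪-regular (∁-regular L-regular) (Resolved-regular j)))

  Accepted∈BΣ₁ : ∀ j → BΣ₁[ regular ] (Accepted j)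
  Accepted∈BΣ₁ zero = Resolved∈BΣ₁ zero
  Accepted∈BΣ₁ (suc j) = union
    (intersection (Core∈BΣ₁ (∪-regular L-regular (Resolved-regular j))) (complement (Resolved∈BΣ₁ j)))
    (Accepted∈BΣ₁ j)

  Accepted⊆ : ∀ j → Accepted j ⊆ L
  Accepted⊆ (suc j) (inj₁ (c , ¬r)) with Core⊆ {K = L ∪ Resolved j} c
  ... | inj₁ l = l
  ... | inj₂ r = ⊥-elim (¬r r)
  Accepted⊆ (suc j) (inj₂ a) = Accepted⊆ j a

  -- At the first stage that resolves a word of `L`, the certificate cannot be for
  -- `∁ L ∪ Resolved j`: the word is neither outside `L` nor resolved earlier.
  ⊆Accepted : ∀ j → L ∩ Resolved j ⊆ Accepted j
  ⊆Accepted (suc j) {w} (l , r) with Reg⇒decidable (Resolved-regular j) w | r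
  ... | yes r′ | _      = inj₂ (⊆Accepted j (l , r′))
  ... | no ¬r′ | inj₁ c = inj₁ (c , ¬r′)
  ... | no ¬r′ | inj₂ c with Core⊆ {K = ∁ L ∪ Resolved j} c
  ...   | inj₁ ¬l = ⊥-elim (¬l l)
  ...   | inj₂ r′ = ⊥-elim (¬r′ r′)

module _ {A : Set} {k : ℕ} (A↔Fin : A ↔ Fin k) {L : Language A} (L-regular : Reg L) {Us : List (Language A)}
         (certified : All Certified Us) (determined : ∀ v w → SameMembership Us v w → L v ⇔ L w) where
  open FiniteAlphabet A↔Fin
  open Alternation A↔Fin L-regular (width certified)

  -- Induction on `j`: a word agreeing with `w` on the joint certificate has the same memberships,
  -- or at least one miss fewer, which pays for going down one stage.
  few-misses⇒Resolved : ∀ j w → Fin (length w) → (us : Decisions Us w) → misses us < j → Resolved j w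
  few-misses⇒Resolved (suc j) w p us (s≤s m≤j) = case Reg⇒decidable L-regular w of λ where
      (yes l) → inj₁ (i , λ v e → decidable-stable
        (Reg⇒decidable (∪-regular L-regular (Resolved-regular j)) (toList v))
        λ ¬x → undecided v e (¬x ∘ inj₂) λ eq → ¬x (inj₁ (to eq l)))
      (no ¬l) → inj₂ (i , λ v e → decidable-stable
        (Reg⇒decidable (∪-regular (∁-regular L-regular) (Resolved-regular j)) (toList v))
        λ ¬x → undecided v e (¬x ∘ inj₂) λ eq → ¬x (inj₁ (¬l ∘ from eq)))
    where
    i = proj₁ (joint-certificate certified w p us)

    undecided : ∀ v → map (lookup v) i ≡ map (lookup (fromList w)) i → ¬ Resolved j (toList v) →
                ¬ ¬ (L w ⇔ L (toList v))
    undecided v e ¬r ¬eq = ¬¬-decisions Us (toList v) λ us′ →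
      case misses-decrease us us′ (proj₂ (joint-certificate certified w p us) v e) of λ where
        (inj₁ lt) → ¬r (few-misses⇒Resolved j (toList v) (subst Fin (sym (length-toList v)) p) us′
                          (<-≤-trans lt m≤j))
        (inj₂ (_ , same)) → ¬eq (determined w (toList v) same)

  private
    J : ℕ
    -- At most `length Us` languages are missed, and the bound in `few-misses⇒Resolved` is strict.
    J = suc (length Us)

    nonempty-Resolved : ∀ a w → Resolved J (a ∷ w)
    nonempty-Resolved a w = decidable-stable (Reg⇒decidable (Resolved-regular J) (a ∷ w)) λ ¬r →
      ¬¬-decisions Us (a ∷ w) λ us → ¬r (few-misses⇒Resolved J (a ∷ w) zero us (s≤s (misses≤length us)))

    -- A one-position certificate exists only in a nonempty word, so the complement isolates the
    -- empty word.
    Nonempty : Language A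
    Nonempty = Core 1 U

    nonempty : ∀ a w → Nonempty (a ∷ w)
    nonempty a w = zero ∷ [] , _

    Nonempty∈BΣ₁ : BΣ₁[ regular ] Nonempty
    Nonempty∈BΣ₁ = member (Core-Σ₁ (Reg-resp-≐ ((λ _ → tt) , (λ _ ())) (∁-regular ∅-regular)) 0)

  -- The empty word has no positions and is never resolved, so its membership in `L` is settled
  -- separately. On all other words `Accepted J` coincides with `L`.
  generated⇒BΣ₁ : BΣ₁[ regular ] L
  generated⇒BΣ₁ with Reg⇒decidable L-regular []
  ... | no ¬ε = resp-≐ (Accepted⊆ J , L⊆Accepted) (Accepted∈BΣ₁ J)
    where
    L⊆Accepted : L ⊆ Accepted J
    L⊆Accepted {[]} l = ⊥-elim (¬ε l)
    L⊆Accepted {a ∷ w} l = ⊆Accepted J (l , nonempty-Resolved a w)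
  ... | yes ε = resp-≐ (⊆L , L⊆) (union (complement Nonempty∈BΣ₁) (Accepted∈BΣ₁ J))
    where
    ⊆L : ∁ Nonempty ∪ Accepted J ⊆ L
    ⊆L {[]} _ = ε
    ⊆L {a ∷ w} (inj₁ empty) = ⊥-elim (empty (nonempty a w))
    ⊆L {a ∷ w} (inj₂ acc) = Accepted⊆ J acc

    L⊆ : L ⊆ ∁ Nonempty ∪ Accepted J
    L⊆ {[]} _ = inj₁ λ { (() ∷ _ , _) }
    L⊆ {a ∷ w} l = inj₂ (⊆Accepted J (l , nonempty-Resolved a w))

theorem2 : (A : Set) (k : ℕ) → A ↔ Fin k →
    ((Σ₁[ arbitrary {A} ] ∩ Reg) ≐ Σ₁[ regular {A} ]) ×
    ((BΣ₁[ arbitrary {A} ] ∩ Reg) ≐ BΣ₁[ regular {A} ])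
theorem2 A k A↔Fin =
  ( (λ { {L} (σ , r) → Σ₁-case L σ r })
  , (λ σ → Σ₁⊆Σ₁[arbitrary] σ , Σ₁[regular]⇒Reg σ)) ,
  ( (λ (β , r) → let _ , certified , determined = generators β in generated⇒BΣ₁ A↔Fin r certified determined)
  , (λ β → BooleanClosure-mono Σ₁⊆Σ₁[arbitrary] β , BooleanClosure-regular Σ₁[regular]⇒Reg β))
  where
  open FiniteAlphabet A↔Fin

  Σ₁-case : ∀ L → Σ₁[ arbitrary ] L → Reg L → Σ₁[ regular ] L
  Σ₁-case L σ r = let d , L⊆Core = Σ₁⇒Certified {L = L} σ ; ψ , Core⊆ψ , ψ⊆Core = Core-Σ₁ r d in
    ψ , Core⊆ψ ∘ L⊆Core , Core⊆ {K = L} ∘ ψ⊆Core
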